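{- The process of building a computon data flow graph (DFG) is functorial, i.e., the assignment $\mathscr{D}\colon\mathbf{Set}^{\mathbf{Comp}}\to\mathbf{Set}^{\mathbf{Gr}}$ is a functor.
   Context: $\mathbf{Set}$ is the category of finite sets and total functions. A computon $\lambda$ is a tuple $(U,P,I,O,\Sigma,\sigma,\tau,t,s,c)$ (a functor into $\mathbf{Set}$ from the free category on the arrows $\sigma:O\to U$, $\tau:I\to U$, $t:O\to P$, $s:I\to P$, $c:P\to\Sigma$) where $U$ (computation units), $I$ and $O$ (edges) are possibly empty finite sets, $P$ (ports) is a non-empty finite set, $\Sigma\subset\mathbb{N}$ (colours) is finite with $0\in\Sigma$, the functions $\sigma,\tau,c$ are surjective, and: the restrictions $\sigma|_{(c\circ t)^{ -1}(0)}$ and $\tau|_{(c\circ s)^{ -1}(0)}$ are surjective onto $U$; there is $p\in P\setminus \mathrm{Im}(s)$ with $c(p)=0$; there is $q\in P\setminus \mathrm{Im}(t)$ with $c(q)=0$. Components of $\lambda_j$ carry the subscript $j$. Put $P^+=P\setminus \mathrm{Im}(t)$ and $P^-=P\setminus \mathrm{Im}(s)$. For a port $p$, $\bullet p=\{u\in U\mid \exists o\in O,\ \sigma(o)=u,\ t(o)=p\}$ and $p\bullet=\{u\in U\mid\exists i\in I,\ s(i)=p,\ \tau(i)=u\}$. A computon morphism $\alpha:\lambda_1\to\lambda_2$ is a natural transformation (functions $\alpha_U,\alpha_P,\alpha_I,\alpha_O,\alpha_\Sigma$ commuting with $\sigma,\tau,t,s,c$) such that $\alpha_\Sigma$ is the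 inclusion $\Sigma_1\subseteq\Sigma_2$ and $\vec{i}(\alpha)\cup\vec{o}(\alpha)\subseteq P_1^+\cup P_1^-$, where $\vec{i}(\alpha)=\{p\in P_1\mid \bullet\alpha(p)\setminus\alpha(\bullet p)\ne\emptyset\}$ and $\vec{o}(\alpha)=\{p\in P_1\mid \alpha(p)\bullet\setminus\alpha(p\bullet)\neq\emptyset\}$. Computons and computon morphisms form the category $\mathbf{Set}^{\mathbf{Comp}}$ (componentwise composition). $\mathbf{Set}^{\mathbf{Gr}}$ is the category of directed labelled graphs: objects consist of sets $E,V,L$ with functions $\vec{s},\vec{t}:E\to V$ and $l:V\to L$; morphisms are triples of functions on $E,V,L$ commuting with $\vec s,\vec t,l$. The sets $U$ and $P$ (respectively $I$ and $O$) of a computon are regarded as disjoint, and $\kappa$ is a fixed label with $\kappa\notin\mathbb{N}$. The DFG $\mathscr{D}(\lambda)$ has $V=U\cup\{p\in P\mid c(p)>0\}$; $E=\{i\in I\mid c(s(i))>0\}\cup\{o\in O\mid c(t(o))>0\}$; $L=\Sigma\cup\{\kappa\}$; $\vec{s}(e)=s(e)$ if $e\in I$ and $\sigma(e)$ if $e\in O$; $\vec{t}(e)=t(e)$ if $e\in O$ and $\tau(e)$ if $e\in I$; $l(v)=c(v)$ if $v\in P$ and $\kappa$ if $v\in U$. For a computon morphism $\alpha:\lambda_1\to\lambda_2$, $\mathscr{D}(\alpha)$ has components $\mathscr{D}(\alpha)_V(v)=\alpha_U(v)$ if $v\in U_1$ and $\alpha_P(v)$ if $v\in P_1$; $\mathscr{D}(\alpha)_E(e)=\alpha_I(e)$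 if $e\in I_1$ and $\alpha_O(e)$ if $e\in O_1$; $\mathscr{D}(\alpha)_L(x)=\alpha_\Sigma(x)$ if $x\in\Sigma_1$ and $\kappa$ otherwise. -}

module Defs where

open import Data.Empty using (⊥-elim; ⊥-elim-irr)
open import Data.Fin.Base using (Fin; zero; suc)
open import Data.Fin.Properties using (+↔⊎; 1↔⊤; any?; inj⇒≟)
open import Data.Irrelevant using ([_])
open import Data.Nat.Base using (ℕ; zero; suc; _+_; _<_)
open import Data.Nat.Properties using (_<?_)
open import Data.Product.Base using (∃; _×_; _,_)
open import Data.Refinement using (Refinement-syntax; value; _,_; value-injective)
open import Data.Sum.Base as Sum using (_⊎_; inj₁; inj₂; [_,_]′)
open import Data.Sum.Function.Propositional using (_⊎-↔_)
open import Data.Unit.Base using (⊤; tt)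
open import Function.Base using (_∘′_; id)
open import Function.Bundles using (_↔_; Inverse; mk↔ₛ′)
open import Function.Construct.Composition using (_↔-∘_)
open import Function.Construct.Symmetry using (↔-sym)
open import Function.Definitions using (StrictlySurjective)
open import Function.Properties.Inverse using (↔⇒↣)
open import Level using (Level; 0ℓ) renaming (suc to lsuc; _⊔_ to _⊔ℓ_)
open import Relation.Binary.Definitions using (DecidableEquality)
open import Relation.Binary.PropositionalEquality
  using (_≡_; refl; sym; trans; cong; subst; _≗_)
open import Relation.Binary.Structures using (IsEquivalence)
open import Relation.Nullary.Negation using (¬_)
open import Relation.Nullary.Decidable using (Dec; yes; no; map′; _×-dec_)
open import Relation.Unary
  using (Pred; Decidable; Satisfiable; _∈_; _∉_; _⊆_; _∪_; _∖_)

-- Morphisms are compared by a hom-set equivalence: without function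
-- extensionality, pointwise equality is the right equality of functions.

record Category (o h e : Level) : Set (lsuc (o ⊔ℓ h ⊔ℓ e)) where
  infix  4 _≈_ _⇒_
  infixr 9 _∘_
  field
    Obj       : Set o
    _⇒_       : Obj → Obj → Set h
    _≈_       : ∀ {A B} → A ⇒ B → A ⇒ B → Set e
    idm       : ∀ A → A ⇒ A
    _∘_       : ∀ {A B C} → B ⇒ C → A ⇒ B → A ⇒ C
    ≈-equiv   : ∀ {A B} → IsEquivalence (_≈_ {A} {B})
    ∘-cong    : ∀ {A B C} {g g′ : B ⇒ C} {f f′ : A ⇒ B} →
                g ≈ g′ → f ≈ f′ → g ∘ f ≈ g′ ∘ f′
    identityˡ : ∀ {A B} (f : A ⇒ B) → idm B ∘ f ≈ f
    identityʳ : ∀ {A B} (f : A ⇒ B) → f ∘ idm A ≈ f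
    assoc     : ∀ {A B C D} (h : C ⇒ D) (g : B ⇒ C) (f : A ⇒ B) →
                (h ∘ g) ∘ f ≈ h ∘ (g ∘ f)

record IsFunctor {o h e o′ h′ e′ : Level}
                 (𝒞 : Category o h e) (𝒟 : Category o′ h′ e′)
                 (F₀ : Category.Obj 𝒞 → Category.Obj 𝒟)
                 (F₁ : ∀ {A B} → Category._⇒_ 𝒞 A B → Category._⇒_ 𝒟 (F₀ A) (F₀ B))
                 : Set (o ⊔ℓ h ⊔ℓ e ⊔ℓ e′) where
  private
    module C = Category 𝒞
    module D = Category 𝒟
  field
    resp-≈      : ∀ {A B} {f g : A C.⇒ B} → f C.≈ g → F₁ f D.≈ F₁ g
    identity    : ∀ A → F₁ (C.idm A) D.≈ D.idm (F₀ A)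
    composition : ∀ {A B C} (g : B C.⇒ C) (f : A C.⇒ B) →
                  F₁ (g C.∘ f) D.≈ F₁ g D.∘ F₁ f

Finite : Set → Set
Finite A = ∃ λ n → A ↔ Fin n

private
  variable
    A B : Set

finite-≟ : Finite A → DecidableEquality A
finite-≟ (_ , A↔n) = inj⇒≟ (↔⇒↣ A↔n)

finite-any? : ∀ {ℓ} {Q : Pred A ℓ} → Finite A → Decidable Q → Dec (∃ Q)
finite-any? {Q = Q} (_ , A↔n) Q? =
  map′ (λ (i , q) → from i , q)
       (λ (x , q) → to x , subst Q (sym (strictlyInverseʳ x)) q)
       (any? (λ i → Q? (from i)))
  where open Inverse A↔n

finite-⊤ : Finite ⊤
finite-⊤ = 1 , ↔-sym 1↔⊤

finite-⊎ : Finite A → Finite B → Finite (A ⊎ B)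
finite-⊎ (m , A↔m) (n , B↔n) = m + n , (↔-sym +↔⊎ ↔-∘ (A↔m ⊎-↔ B↔n))

private
  module _ {n} {Q : Pred (Fin (suc n)) 0ℓ} where
    Subset Tail : Set
    Subset = [ i ∈ Fin (suc n) ∣ Q i ]
    Tail   = [ i ∈ Fin n ∣ Q (suc i) ]

    extend : Tail → Subset
    extend (i , r) = suc i , r

    with-zero : Q zero → Subset ↔ (⊤ ⊎ Tail)
    with-zero q = mk↔ₛ′ to from to∘from from∘to
      where
      to : Subset → ⊤ ⊎ Tail
      to (zero  , _) = inj₁ tt
      to (suc i , r) = inj₂ (i , r)

      from : ⊤ ⊎ Tail → Subset
      from = [ (λ _ → zero , [ q ]) , extend ]′

      to∘from : ∀ y → to (from y) ≡ y
      to∘from (inj₁ _) = refl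
      to∘from (inj₂ _) = refl

      from∘to : ∀ x → from (to x) ≡ x
      from∘to (zero  , _) = value-injective refl
      from∘to (suc i , _) = refl

    without-zero : ¬ Q zero → Subset ↔ Tail
    without-zero ¬q = mk↔ₛ′ to extend (λ _ → refl) from∘to
      where
      to : Subset → Tail
      to (zero  , [ q ]) = ⊥-elim-irr (¬q q)
      to (suc i , r)     = i , r

      from∘to : ∀ x → extend (to x) ≡ x
      from∘to (zero  , [ q ]) = ⊥-elim-irr (¬q q)
      from∘to (suc i , _)     = refl

  fin-subset : ∀ n {Q : Pred (Fin n) 0ℓ} → Decidable Q → Finite [ i ∈ Fin n ∣ Q i ]
  fin-subset zero    Q? = 0 , mk↔ₛ′ value (λ ()) (λ ()) (λ { (() , _) })
  fin-subset (suc n) Q? with Q? zero | fin-subset n (λ i → Q? (suc i))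
  ... | yes q | tail     = let (m , ts) = finite-⊎ finite-⊤ tail in m , (ts ↔-∘ with-zero q)
  ... | no ¬q | (m , ts) = m , (ts ↔-∘ without-zero ¬q)

finite-subset : {Q : Pred A 0ℓ} → Decidable Q → Finite A → Finite [ x ∈ A ∣ Q x ]
finite-subset {Q = Q} Q? (n , A↔n) =
  let (m , s) = fin-subset n (λ i → Q? (from i)) in m , (s ↔-∘ mk↔ₛ′
    (λ { (x , [ q ]) → to x , [ subst Q (sym (strictlyInverseʳ x)) q ] })
    (λ { (i , q) → from i , q })
    (λ { (i , _) → value-injective (strictlyInverseˡ i) })
    (λ { (x , _) → value-injective (strictlyInverseʳ x) }))
  where open Inverse A↔n

Im : (A → B) → Pred B 0ℓ
Im f y = ∃ λ x → f x ≡ y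

image : (A → B) → Pred A 0ℓ → Pred B 0ℓ
image f X y = ∃ λ x → x ∈ X × f x ≡ y

_↾_ : (A → B) → (Q : Pred A 0ℓ) → [ x ∈ A ∣ Q x ] → B
(f ↾ Q) x = f (value x)

record Computon : Set₁ where
  field
    U P I O : Set
    Colours : Pred ℕ 0ℓ

  -- The set written Σ in the tuple, as a type: two of its elements are equal
  -- as soon as they are equal as numbers.
  Colour : Set
  Colour = [ n ∈ ℕ ∣ n ∈ Colours ]

  field
    σ : O → U
    τ : I → U
    t : O → P
    s : I → P
    c : P → Colour

    U-finite      : Finite U
    P-finite      : Finite P
    I-finite      : Finite I
    O-finite      : Finite O
    Colour-finite : Finite Colour
    P-nonempty    : P
    0∈Colours     : 0 ∈ Colours

  colour : P → ℕ
  colour p = value (c p)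

  P⁺ : Pred P 0ℓ
  P⁺ p = p ∉ Im t

  P⁻ : Pred P 0ℓ
  P⁻ p = p ∉ Im s

  field
    σ-surjective  : StrictlySurjective _≡_ σ
    τ-surjective  : StrictlySurjective _≡_ τ
    c-surjective  : StrictlySurjective _≡_ c
    σ₀-surjective : StrictlySurjective _≡_ (σ ↾ λ o → colour (t o) ≡ 0)
    τ₀-surjective : StrictlySurjective _≡_ (τ ↾ λ i → colour (s i) ≡ 0)
    P⁻-control    : ∃ λ p → p ∈ P⁻ × colour p ≡ 0
    P⁺-control    : ∃ λ q → q ∈ P⁺ × colour q ≡ 0

  infix 10 •_ _•
  •_ : P → Pred U 0ℓ
  • p = λ u → ∃ λ o → σ o ≡ u × t o ≡ p

  _• : P → Pred U 0ℓ
  p • = λ u → ∃ λ i → τ i ≡ u × s i ≡ p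

module _ (C₁ C₂ : Computon) where
  private
    module C₁ = Computon C₁
    module C₂ = Computon C₂
  open C₁ using () renaming (•_ to •₁_; _• to _•₁)
  open C₂ using () renaming (•_ to •₂_; _• to _•₂)

  record ComputonMorphism : Set where
    field
      αU : C₁.U → C₂.U
      αP : C₁.P → C₂.P
      αI : C₁.I → C₂.I
      αO : C₁.O → C₂.O
      αΣ : C₁.Colour → C₂.Colour

      σ-natural : ∀ o → αU (C₁.σ o) ≡ C₂.σ (αO o)
      τ-natural : ∀ i → αU (C₁.τ i) ≡ C₂.τ (αI i)
      t-natural : ∀ o → αP (C₁.t o) ≡ C₂.t (αO o)
      s-natural : ∀ i → αP (C₁.s i) ≡ C₂.s (αI i)
      c-natural : ∀ p → αΣ (C₁.c p) ≡ C₂.c (αP p)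

      αΣ-inclusion : ∀ x → value (αΣ x) ≡ value x

    i⃗ : Pred C₁.P 0ℓ
    i⃗ p = Satisfiable ((•₂ αP p) ∖ image αU (•₁ p))

    o⃗ : Pred C₁.P 0ℓ
    o⃗ p = Satisfiable ((αP p •₂) ∖ image αU (p •₁))

    field
      boundary : (i⃗ ∪ o⃗) ⊆ (C₁.P⁺ ∪ C₁.P⁻)

    colour-preserved : ∀ p → C₁.colour p ≡ C₂.colour (αP p)
    colour-preserved p =
      trans (sym (αΣ-inclusion (C₁.c p))) (cong value (c-natural p))

open ComputonMorphism

record _≈ᶜ_ {C₁ C₂ : Computon} (α β : ComputonMorphism C₁ C₂) : Set where
  field
    ≈U : αU α ≗ αU β
    ≈P : αP α ≗ αP β
    ≈I : αI α ≗ αI β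
    ≈O : αO α ≗ αO β
    ≈Σ : αΣ α ≗ αΣ β

open _≈ᶜ_

idᶜ : ∀ C → ComputonMorphism C C
idᶜ C = record
  { αU = id ; αP = id ; αI = id ; αO = id ; αΣ = id
  ; σ-natural = λ _ → refl ; τ-natural = λ _ → refl ; t-natural = λ _ → refl
  ; s-natural = λ _ → refl ; c-natural = λ _ → refl
  ; αΣ-inclusion = λ _ → refl
  ; boundary = λ
      { (inj₁ (u , u∈ , u∉)) → ⊥-elim (u∉ (u , u∈ , refl))
      ; (inj₂ (u , u∈ , u∉)) → ⊥-elim (u∉ (u , u∈ , refl)) }
  }

private
  -- If the composite h ∘ f creates a new neighbour v, either f already creates
  -- one, or h does at the image of the port; the case distinction needs
  -- membership of v in the intermediate image to be decidable.
  new-neighbour : {U₁ U₂ U₃ : Set} (f : U₁ → U₂) (h : U₂ → U₃)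
    {N₁ : Pred U₁ 0ℓ} {N₂ : Pred U₂ 0ℓ} {N₃ : Pred U₃ 0ℓ} →
    Decidable (image h N₂) →
    Satisfiable (N₃ ∖ image (h ∘′ f) N₁) →
    Satisfiable (N₂ ∖ image f N₁) ⊎ Satisfiable (N₃ ∖ image h N₂)
  new-neighbour f h d? (v , v∈ , v∉) with d? v
  ... | no v∉h = inj₂ (v , v∈ , v∉h)
  ... | yes (u , u∈ , refl) =
        inj₁ (u , u∈ , λ { (w , w∈ , refl) → v∉ (w , w∈ , refl) })

_∘ᶜ_ : ∀ {C₁ C₂ C₃} →
       ComputonMorphism C₂ C₃ → ComputonMorphism C₁ C₂ → ComputonMorphism C₁ C₃
_∘ᶜ_ {C₁} {C₂} {C₃} β α = record
  { αU = αU β ∘′ αU α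
  ; αP = αP β ∘′ αP α
  ; αI = αI β ∘′ αI α
  ; αO = αO β ∘′ αO α
  ; αΣ = αΣ β ∘′ αΣ α
  ; σ-natural = λ o → trans (cong (αU β) (σ-natural α o)) (σ-natural β (αO α o))
  ; τ-natural = λ i → trans (cong (αU β) (τ-natural α i)) (τ-natural β (αI α i))
  ; t-natural = λ o → trans (cong (αP β) (t-natural α o)) (t-natural β (αO α o))
  ; s-natural = λ i → trans (cong (αP β) (s-natural α i)) (s-natural β (αI α i))
  ; c-natural = λ p → trans (cong (αΣ β) (c-natural α p)) (c-natural β (αP α p))
  ; αΣ-inclusion = λ x → trans (αΣ-inclusion β (αΣ α x)) (αΣ-inclusion α x)
  ; boundary = λ
      { {p} (inj₁ new) →
          [ (λ n → boundary α (inj₁ n)) , (λ n → reflect p (boundary β (inj₁ n))) ]′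
            (new-neighbour (αU α) (αU β) (decᵢ (αP α p)) new)
      ; {p} (inj₂ new) →
          [ (λ n → boundary α (inj₂ n)) , (λ n → reflect p (boundary β (inj₂ n))) ]′
            (new-neighbour (αU α) (αU β) (decₒ (αP α p)) new) }
  }
  where
  module C₁ = Computon C₁
  module C₂ = Computon C₂
  module C₃ = Computon C₃

  reflect : ∀ p → αP α p ∈ C₂.P⁺ ∪ C₂.P⁻ → p ∈ C₁.P⁺ ∪ C₁.P⁻
  reflect p = Sum.map
    (λ { ∉t (o , refl) → ∉t (αO α o , sym (t-natural α o)) })
    (λ { ∉s (i , refl) → ∉s (αI α i , sym (s-natural α i)) })

  U₂≟ = finite-≟ C₂.U-finite
  P₂≟ = finite-≟ C₂.P-finite
  U₃≟ = finite-≟ C₃.U-finite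

  decᵢ : ∀ q → Decidable (image (αU β) (C₂.•_ q))
  decᵢ q v = finite-any? C₂.U-finite λ u →
    finite-any? C₂.O-finite (λ o → U₂≟ (C₂.σ o) u ×-dec P₂≟ (C₂.t o) q)
      ×-dec U₃≟ (αU β u) v

  decₒ : ∀ q → Decidable (image (αU β) (C₂._• q))
  decₒ q v = finite-any? C₂.U-finite λ u →
    finite-any? C₂.I-finite (λ i → U₂≟ (C₂.τ i) u ×-dec P₂≟ (C₂.s i) q)
      ×-dec U₃≟ (αU β u) v

Set^Comp : Category (lsuc 0ℓ) 0ℓ 0ℓ
Set^Comp = record
  { Obj = Computon
  ; _⇒_ = ComputonMorphism
  ; _≈_ = _≈ᶜ_
  ; idm = idᶜ
  ; _∘_ = _∘ᶜ_
  ; ≈-equiv = record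
    { refl  = record
      { ≈U = λ _ → refl ; ≈P = λ _ → refl ; ≈I = λ _ → refl
      ; ≈O = λ _ → refl ; ≈Σ = λ _ → refl }
    ; sym   = λ e → record
      { ≈U = λ x → sym (≈U e x) ; ≈P = λ x → sym (≈P e x) ; ≈I = λ x → sym (≈I e x)
      ; ≈O = λ x → sym (≈O e x) ; ≈Σ = λ x → sym (≈Σ e x) }
    ; trans = λ e f → record
      { ≈U = λ x → trans (≈U e x) (≈U f x)
      ; ≈P = λ x → trans (≈P e x) (≈P f x)
      ; ≈I = λ x → trans (≈I e x) (≈I f x)
      ; ≈O = λ x → trans (≈O e x) (≈O f x)
      ; ≈Σ = λ x → trans (≈Σ e x) (≈Σ f x) }
    }
  ; ∘-cong = λ {_} {_} {_} {g} {_} {_} {f′} e d → record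
      { ≈U = λ x → trans (cong (αU g) (≈U d x)) (≈U e (αU f′ x))
      ; ≈P = λ x → trans (cong (αP g) (≈P d x)) (≈P e (αP f′ x))
      ; ≈I = λ x → trans (cong (αI g) (≈I d x)) (≈I e (αI f′ x))
      ; ≈O = λ x → trans (cong (αO g) (≈O d x)) (≈O e (αO f′ x))
      ; ≈Σ = λ x → trans (cong (αΣ g) (≈Σ d x)) (≈Σ e (αΣ f′ x)) }
  ; identityˡ = λ _ → record
    { ≈U = λ _ → refl ; ≈P = λ _ → refl ; ≈I = λ _ → refl
    ; ≈O = λ _ → refl ; ≈Σ = λ _ → refl }
  ; identityʳ = λ _ → record
    { ≈U = λ _ → refl ; ≈P = λ _ → refl ; ≈I = λ _ → refl
    ; ≈O = λ _ → refl ; ≈Σ = λ _ → refl }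
  ; assoc = λ _ _ _ → record
    { ≈U = λ _ → refl ; ≈P = λ _ → refl ; ≈I = λ _ → refl
    ; ≈O = λ _ → refl ; ≈Σ = λ _ → refl }
  }

record Graph : Set₁ where
  field
    E V L    : Set
    s⃗ t⃗      : E → V
    l        : V → L
    E-finite : Finite E
    V-finite : Finite V
    L-finite : Finite L

record GraphMap (G H : Graph) : Set where
  private
    module G = Graph G
    module H = Graph H
  field
    fE : G.E → H.E
    fV : G.V → H.V
    fL : G.L → H.L

record IsGraphMorphism {G H : Graph} (f : GraphMap G H) : Set where
  private
    module G = Graph G
    module H = Graph H
  open GraphMap f
  field
    s⃗-natural : ∀ e → fV (G.s⃗ e) ≡ H.s⃗ (fE e)
    t⃗-natural : ∀ e → fV (G.t⃗ e) ≡ H.t⃗ (fE e)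
    l-natural : ∀ v → fL (G.l v) ≡ H.l (fV v)

record GraphMorphism (G H : Graph) : Set where
  constructor _,_
  field
    graphMap        : GraphMap G H
    isGraphMorphism : IsGraphMorphism graphMap
  open GraphMap graphMap public
  open IsGraphMorphism isGraphMorphism public

record _≈ᵍ_ {G H : Graph} (f g : GraphMorphism G H) : Set where
  private
    module f = GraphMorphism f
    module g = GraphMorphism g
  field
    ≈E : f.fE ≗ g.fE
    ≈V : f.fV ≗ g.fV
    ≈L : f.fL ≗ g.fL

open _≈ᵍ_
open GraphMorphism using (fE; fV; fL)

idᵍ : ∀ G → GraphMorphism G G
idᵍ G = record { fE = id ; fV = id ; fL = id }
      , record { s⃗-natural = λ _ → refl ; t⃗-natural = λ _ → refl
               ; l-natural = λ _ → refl }

_∘ᵍ_ : ∀ {G H K} → GraphMorphism H K → GraphMorphism G H → GraphMorphism G K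
g ∘ᵍ f = record { fE = g.fE ∘′ f.fE ; fV = g.fV ∘′ f.fV ; fL = g.fL ∘′ f.fL }
       , record
         { s⃗-natural = λ e → trans (cong g.fV (f.s⃗-natural e)) (g.s⃗-natural (f.fE e))
         ; t⃗-natural = λ e → trans (cong g.fV (f.t⃗-natural e)) (g.t⃗-natural (f.fE e))
         ; l-natural = λ v → trans (cong g.fL (f.l-natural v)) (g.l-natural (f.fV v)) }
  where
  module f = GraphMorphism f
  module g = GraphMorphism g

Set^Gr : Category (lsuc 0ℓ) 0ℓ 0ℓ
Set^Gr = record
  { Obj = Graph
  ; _⇒_ = GraphMorphism
  ; _≈_ = _≈ᵍ_
  ; idm = idᵍ
  ; _∘_ = _∘ᵍ_
  ; ≈-equiv = record
    { refl  = record { ≈E = λ _ → refl ; ≈V = λ _ → refl ; ≈L = λ _ → refl }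
    ; sym   = λ e → record
      { ≈E = λ x → sym (≈E e x) ; ≈V = λ x → sym (≈V e x) ; ≈L = λ x → sym (≈L e x) }
    ; trans = λ e f → record
      { ≈E = λ x → trans (≈E e x) (≈E f x)
      ; ≈V = λ x → trans (≈V e x) (≈V f x)
      ; ≈L = λ x → trans (≈L e x) (≈L f x) }
    }
  ; ∘-cong = λ {_} {_} {_} {g} {_} {_} {f′} e d → record
      { ≈E = λ x → trans (cong (fE g) (≈E d x)) (≈E e (fE f′ x))
      ; ≈V = λ x → trans (cong (fV g) (≈V d x)) (≈V e (fV f′ x))
      ; ≈L = λ x → trans (cong (fL g) (≈L d x)) (≈L e (fL f′ x)) }
  ; identityˡ = λ _ → record { ≈E = λ _ → refl ; ≈V = λ _ → refl ; ≈L = λ _ → refl }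
  ; identityʳ = λ _ → record { ≈E = λ _ → refl ; ≈V = λ _ → refl ; ≈L = λ _ → refl }
  ; assoc = λ _ _ _ → record { ≈E = λ _ → refl ; ≈V = λ _ → refl ; ≈L = λ _ → refl }
  }

module _ (C : Computon) where
  open Computon C

  DataPort DataIn DataOut : Set
  DataPort = [ p ∈ P ∣ 0 < colour p ]
  DataIn   = [ i ∈ I ∣ 0 < colour (s i) ]
  DataOut  = [ o ∈ O ∣ 0 < colour (t o) ]

-- The label κ ∉ ℕ is the element inj₂ tt of Colour ⊎ ⊤.
pattern κ = inj₂ tt

𝒟₀ : Computon → Graph
𝒟₀ C = record
  { E = DataIn C ⊎ DataOut C
  ; V = U ⊎ DataPort C
  ; L = Colour ⊎ ⊤
  ; s⃗ = λ { (inj₁ (i , pos)) → inj₂ (s i , pos)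
          ; (inj₂ (o , _))   → inj₁ (σ o) }
  ; t⃗ = λ { (inj₁ (i , _))   → inj₁ (τ i)
          ; (inj₂ (o , pos)) → inj₂ (t o , pos) }
  ; l = λ { (inj₁ _)       → κ
          ; (inj₂ (p , _)) → inj₁ (c p) }
  ; E-finite = finite-⊎ (finite-subset (λ i → 0 <? colour (s i)) I-finite)
                        (finite-subset (λ o → 0 <? colour (t o)) O-finite)
  ; V-finite = finite-⊎ U-finite (finite-subset (λ p → 0 <? colour p) P-finite)
  ; L-finite = finite-⊎ Colour-finite finite-⊤
  }
  where open Computon C

module _ {C₁ C₂ : Computon} (α : ComputonMorphism C₁ C₂) where
  private
    module C₁ = Computon C₁
    module C₂ = Computon C₂

  mapDataPort : DataPort C₁ → DataPort C₂
  mapDataPort (p , [ pos ]) =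
    αP α p , [ subst (0 <_) (colour-preserved α p) pos ]

  mapDataIn : DataIn C₁ → DataIn C₂
  mapDataIn (i , [ pos ]) = αI α i ,
    [ subst (0 <_) (trans (colour-preserved α (C₁.s i))
                          (cong C₂.colour (s-natural α i))) pos ]

  mapDataOut : DataOut C₁ → DataOut C₂
  mapDataOut (o , [ pos ]) = αO α o ,
    [ subst (0 <_) (trans (colour-preserved α (C₁.t o))
                          (cong C₂.colour (t-natural α o))) pos ]

  𝒟₁ : GraphMap (𝒟₀ C₁) (𝒟₀ C₂)
  𝒟₁ = record
    { fE = Sum.map mapDataIn mapDataOut
    ; fV = Sum.map (αU α) mapDataPort
    ; fL = Sum.map (αΣ α) id
    }

{-# OPTIONS --safe #-}
module Submission where

open import Defs
open import Data.Product.Base using (Σ-syntax; _,_)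
open import Data.Refinement using (_,_; value-injective)
open import Data.Sum.Base using (inj₁; inj₂)
open import Relation.Binary.PropositionalEquality using (refl; cong)

open ComputonMorphism using (σ-natural; τ-natural; t-natural; s-natural; c-natural)
open _≈ᶜ_ using (≈U; ≈P; ≈I; ≈O; ≈Σ)

-- Since `αΣ` is an inclusion, `α` preserves colours, so its components restrict to the ports and
-- edges of positive colour. Each graph square then splits over the two summands into naturality
-- squares of `α`, and the functor laws hold because restriction commutes with identities and
-- composites.

𝒟₁-isGraphMorphism : ∀ {C₁ C₂ : Computon} (α : ComputonMorphism C₁ C₂) →
                     IsGraphMorphism (𝒟₁ α)
𝒟₁-isGraphMorphism α = record
  -- Positivity proofs are irrelevant, so data ports are equal once their underlying ports are.
  { s⃗-natural = λ { (inj₁ (i , _)) → cong inj₂ (value-injective (s-natural α i))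
                   ; (inj₂ (o , _)) → cong inj₁ (σ-natural α o) }
  ; t⃗-natural = λ { (inj₁ (i , _)) → cong inj₁ (τ-natural α i)
                   ; (inj₂ (o , _)) → cong inj₂ (value-injective (t-natural α o)) }
  -- Every unit is labelled `κ`, which the label map fixes.
  ; l-natural  = λ { (inj₁ _)       → refl
                   ; (inj₂ (p , _)) → cong inj₁ (c-natural α p) }
  }

proposition15 : Σ[ natural ∈ (∀ {C₁ C₂ : Computon} (α : ComputonMorphism C₁ C₂) → IsGraphMorphism (𝒟₁ α)) ]
    IsFunctor Set^Comp Set^Gr 𝒟₀ (λ α → 𝒟₁ α , natural α)
proposition15 = 𝒟₁-isGraphMorphism , record
  { resp-≈ = λ α≈β → record
    { ≈E = λ { (inj₁ (i , _)) → cong inj₁ (value-injective (≈I α≈β i))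
             ; (inj₂ (o , _)) → cong inj₂ (value-injective (≈O α≈β o)) }
    ; ≈V = λ { (inj₁ u)       → cong inj₁ (≈U α≈β u)
             ; (inj₂ (p , _)) → cong inj₂ (value-injective (≈P α≈β p)) }
    ; ≈L = λ { (inj₁ x) → cong inj₁ (≈Σ α≈β x)
             ; κ        → refl }
    }
  ; identity = λ _ → record
    -- The case split lets `Sum.map` compute; the two sides then differ at most in irrelevant
    -- positivity proofs, so they agree definitionally.
    { ≈E = λ { (inj₁ _) → refl ; (inj₂ _) → refl }
    ; ≈V = λ { (inj₁ _) → refl ; (inj₂ _) → refl }
    ; ≈L = λ { (inj₁ _) → refl ; κ → refl }
    }
  ; composition = λ _ _ → record
    { ≈E = λ { (inj₁ _) → refl ; (inj₂ _) → refl }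
    ; ≈V = λ { (inj₁ _) → refl ; (inj₂ _) → refl }
    ; ≈L = λ { (inj₁ _) → refl ; κ → refl }
    }
  }
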